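{- Let $n$ be a positive integer and let $d$ be a divisor of $n$. Then for all real numbers $s, t$ with $1 \leq s \leq d$ and $1 \leq t \leq \frac{n}{d}$, $$u(d,s)\cdot u\!\left(\tfrac{n}{d},t\right) \geq u(n,st).$$
   Context: Divisors are positive divisors. For a positive integer $m$ and a real number $k$ with $1 \leq k \leq m$, let $d_1(m,k)$ denote the largest divisor of $m$ that is $\leq k$, and let $d_2(m,k)$ denote the smallest divisor of $m$ that is $\geq k$ (so $d_1(m,k) = d_2(m,k) = k$ if $k$ is a divisor of $m$). Writing $d_i = d_i(m,k)$ for $i=1,2$, define $$u(m,k) = \frac{m}{d_1 d_2}\,(d_1 + d_2 - k).$$ -}

module Defs where

open import Data.Integer.Base using (+_)
open import Data.Nat.Base as ℕ using (ℕ; zero; suc; NonZero; _/_)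
open import Data.Nat.Divisibility
  using (_∣_; 1∣_; ∣-refl; ∣⇒≤; 0∣⇒≡0; n/m≡quotient; quotient≢0)
import Data.Nat.Properties as ℕ
open import Data.Product.Base using (∃; _×_; _,_)
open import Data.Rational.Base as ℚ using (ℚ; 0ℚ; 1ℚ; ½; Positive; positive; ∣_∣)
import Data.Rational.Properties as ℚ
open import Data.Rational.Solver using (module +-*-Solver)
open import Relation.Binary.PropositionalEquality
  using (_≡_; refl; sym; trans; cong; subst)
open import Relation.Nullary.Negation using (¬_)

IsCauchy : (ℕ → ℚ) → Set
IsCauchy x = ∀ ε → Positive ε →
  ∃ λ N → ∀ i j → N ℕ.≤ i → N ℕ.≤ j → ∣ x i ℚ.- x j ∣ ℚ.< ε

record ℝ : Set where
  constructor mkℝ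
  field
    seq    : ℕ → ℚ
    cauchy : IsCauchy seq

open ℝ public

infix  4 _≤ℝ_
infixl 6 _+ℝ_ _-ℝ_
infixl 7 _*ℝ_

-- Cauchy sequences are not quotiented: x and y denote the same real number when
-- x ≤ℝ y and y ≤ℝ x, that is, when their difference tends to 0.

_≤ℝ_ : ℝ → ℝ → Set
x ≤ℝ y = ∀ ε → Positive ε → ∃ λ N → ∀ i → N ℕ.≤ i → seq x i ℚ.≤ seq y i ℚ.+ ε

abstract
  half : ∀ ε → Positive ε → Positive (½ ℚ.* ε)
  half ε ε>0 = ℚ.pos*pos⇒pos ½ ε {{ε>0}}

  halves : ∀ ε → ½ ℚ.* ε ℚ.+ ½ ℚ.* ε ≡ ε
  halves ε = trans (sym (ℚ.*-distribʳ-+ ε ½ ½)) (ℚ.*-identityˡ ε)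

  ⊔ˡ : ∀ {m n o} → m ℕ.⊔ n ℕ.≤ o → m ℕ.≤ o
  ⊔ˡ {m} {n} = ℕ.m⊔n≤o⇒m≤o m n

  ⊔ʳ : ∀ {m n o} → m ℕ.⊔ n ℕ.≤ o → n ℕ.≤ o
  ⊔ʳ {m} {n} = ℕ.m⊔n≤o⇒n≤o m n

  const-cauchy : ∀ q → IsCauchy (λ _ → q)
  const-cauchy q ε ε>0 = 0 , λ _ _ _ _ →
    subst (λ r → ∣ r ∣ ℚ.< ε) (sym (ℚ.+-inverseʳ q)) (ℚ.positive⁻¹ ε {{ε>0}})

  neg-cauchy : ∀ {x} → IsCauchy x → IsCauchy (λ i → ℚ.- x i)
  neg-cauchy {x} cx ε ε>0 with cx ε ε>0
  ... | N , close = N , λ i j N≤i N≤j →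
    subst (ℚ._< ε) (trans (sym (ℚ.∣-p∣≡∣p∣ (x i ℚ.- x j))) (cong ∣_∣ (eq (x i) (x j))))
      (close i j N≤i N≤j)
    where
    open +-*-Solver
    eq : ∀ a b → ℚ.- (a ℚ.- b) ≡ ℚ.- a ℚ.- ℚ.- b
    eq = solve 2 (λ a b → :- (a :- b) := :- a :- :- b) refl

  +-cauchy : ∀ {x y} → IsCauchy x → IsCauchy y → IsCauchy (λ i → x i ℚ.+ y i)
  +-cauchy {x} {y} cx cy ε ε>0 with cx (½ ℚ.* ε) (half ε ε>0) | cy (½ ℚ.* ε) (half ε ε>0)
  ... | M , closeˣ | N , closeʸ = M ℕ.⊔ N , λ i j i≥ j≥ → begin-strict
    ∣ x i ℚ.+ y i ℚ.- (x j ℚ.+ y j) ∣        ≡⟨ cong ∣_∣ (eq (x i) (y i) (x j) (y j)) ⟩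
    ∣ (x i ℚ.- x j) ℚ.+ (y i ℚ.- y j) ∣      ≤⟨ ℚ.∣p+q∣≤∣p∣+∣q∣ (x i ℚ.- x j) (y i ℚ.- y j) ⟩
    ∣ x i ℚ.- x j ∣ ℚ.+ ∣ y i ℚ.- y j ∣      <⟨ ℚ.+-mono-< (closeˣ i j (⊔ˡ i≥) (⊔ˡ j≥))
                                                          (closeʸ i j (⊔ʳ i≥) (⊔ʳ j≥)) ⟩
    ½ ℚ.* ε ℚ.+ ½ ℚ.* ε                      ≡⟨ halves ε ⟩
    ε                                        ∎
    where
    open ℚ.≤-Reasoning
    open +-*-Solver
    eq : ∀ a b c d → a ℚ.+ b ℚ.- (c ℚ.+ d) ≡ (a ℚ.- c) ℚ.+ (b ℚ.- d)
    eq = solve 4 (λ a b c d → a :+ b :- (c :+ d) := (a :- c) :+ (b :- d)) refl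

  eventually-bounded : ∀ {x} → IsCauchy x →
    ∃ λ B → Positive B × ∃ λ N → ∀ i → N ℕ.≤ i → ∣ x i ∣ ℚ.≤ B
  eventually-bounded {x} cx with cx 1ℚ _
  ... | N , close = 1ℚ ℚ.+ ∣ x N ∣ , B>0 , N , λ i N≤i → begin
    ∣ x i ∣                              ≡⟨ cong ∣_∣ (eq (x i) (x N)) ⟩
    ∣ (x i ℚ.- x N) ℚ.+ x N ∣            ≤⟨ ℚ.∣p+q∣≤∣p∣+∣q∣ (x i ℚ.- x N) (x N) ⟩
    ∣ x i ℚ.- x N ∣ ℚ.+ ∣ x N ∣          ≤⟨ ℚ.+-monoˡ-≤ ∣ x N ∣ (ℚ.<⇒≤ (close i N N≤i ℕ.≤-refl)) ⟩
    1ℚ ℚ.+ ∣ x N ∣                       ∎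
    where
    open ℚ.≤-Reasoning
    open +-*-Solver
    eq : ∀ a b → a ≡ (a ℚ.- b) ℚ.+ b
    eq = solve 2 (λ a b → a := (a :- b) :+ b) refl
    B>0 : Positive (1ℚ ℚ.+ ∣ x N ∣)
    B>0 = positive (ℚ.+-mono-<-≤ (ℚ.positive⁻¹ 1ℚ) (ℚ.0≤∣p∣ (x N)))

  divide : ∀ C → Positive C → ∀ ε → Positive ε → ∃ λ δ → Positive δ × C ℚ.* δ ≡ ε
  divide C C>0 ε ε>0 = C⁻¹ ℚ.* ε , ℚ.pos*pos⇒pos C⁻¹ {{ℚ.1/pos⇒pos C {{C>0}}}} ε {{ε>0}} ,
    trans (sym (ℚ.*-assoc C C⁻¹ ε))
      (trans (cong (ℚ._* ε) (ℚ.*-inverseʳ C {{C≢0}})) (ℚ.*-identityˡ ε))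
    where
    C≢0 : ℚ.NonZero C
    C≢0 = ℚ.pos⇒nonZero C {{C>0}}
    C⁻¹ : ℚ
    C⁻¹ = (ℚ.1/ C) {{C≢0}}

  product-< : ∀ {C δ} p q → Positive C → ∣ p ∣ ℚ.≤ C → ∣ q ∣ ℚ.< δ → ∣ p ℚ.* q ∣ ℚ.< C ℚ.* δ
  product-< {C} {δ} p q C>0 p≤C q<δ = begin-strict
    ∣ p ℚ.* q ∣        ≡⟨ ℚ.∣p*q∣≡∣p∣*∣q∣ p q ⟩
    ∣ p ∣ ℚ.* ∣ q ∣    ≤⟨ ℚ.*-monoʳ-≤-nonNeg ∣ q ∣ {{ℚ.∣-∣-nonNeg q}} p≤C ⟩
    C ℚ.* ∣ q ∣        <⟨ ℚ.*-monoʳ-<-pos C {{C>0}} q<δ ⟩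
    C ℚ.* δ            ∎
    where open ℚ.≤-Reasoning

  product-close : ∀ {A B δ} a b c d → Positive A → Positive B →
    ∣ a ∣ ℚ.≤ A → ∣ d ∣ ℚ.≤ B → ∣ a ℚ.- c ∣ ℚ.< δ → ∣ b ℚ.- d ∣ ℚ.< δ →
    ∣ a ℚ.* b ℚ.- c ℚ.* d ∣ ℚ.< (A ℚ.+ B) ℚ.* δ
  product-close {A} {B} {δ} a b c d A>0 B>0 a≤A d≤B a-c<δ b-d<δ = begin-strict
    ∣ a ℚ.* b ℚ.- c ℚ.* d ∣
      ≡⟨ cong ∣_∣ (split a b c d) ⟩
    ∣ a ℚ.* (b ℚ.- d) ℚ.+ d ℚ.* (a ℚ.- c) ∣
      ≤⟨ ℚ.∣p+q∣≤∣p∣+∣q∣ (a ℚ.* (b ℚ.- d)) (d ℚ.* (a ℚ.- c)) ⟩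
    ∣ a ℚ.* (b ℚ.- d) ∣ ℚ.+ ∣ d ℚ.* (a ℚ.- c) ∣
      <⟨ ℚ.+-mono-< (product-< a (b ℚ.- d) A>0 a≤A b-d<δ)
                    (product-< d (a ℚ.- c) B>0 d≤B a-c<δ) ⟩
    A ℚ.* δ ℚ.+ B ℚ.* δ
      ≡⟨ sym (ℚ.*-distribʳ-+ δ A B) ⟩
    (A ℚ.+ B) ℚ.* δ ∎
    where
    open ℚ.≤-Reasoning
    open +-*-Solver
    split : ∀ a b c d → a ℚ.* b ℚ.- c ℚ.* d ≡ a ℚ.* (b ℚ.- d) ℚ.+ d ℚ.* (a ℚ.- c)
    split = solve 4 (λ a b c d →
      a :* b :- c :* d := a :* (b :- d) :+ d :* (a :- c)) refl

  *-cauchy : ∀ {x y} → IsCauchy x → IsCauchy y → IsCauchy (λ i → x i ℚ.* y i)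
  *-cauchy {x} {y} cx cy ε ε>0 =
    let A , A>0 , K , boundˣ = eventually-bounded {x} cx
        B , B>0 , L , boundʸ = eventually-bounded {y} cy
        δ , δ>0 , total      = divide (A ℚ.+ B) (ℚ.pos+pos⇒pos A {{A>0}} B {{B>0}}) ε ε>0
        M , closeˣ           = cx δ δ>0
        N , closeʸ           = cy δ δ>0
    in (K ℕ.⊔ L) ℕ.⊔ (M ℕ.⊔ N) , λ i j i≥ j≥ →
      let i≥KL = ⊔ˡ {K ℕ.⊔ L} {M ℕ.⊔ N} i≥
          i≥MN = ⊔ʳ {K ℕ.⊔ L} {M ℕ.⊔ N} i≥
          j≥KL = ⊔ˡ {K ℕ.⊔ L} {M ℕ.⊔ N} j≥
          j≥MN = ⊔ʳ {K ℕ.⊔ L} {M ℕ.⊔ N} j≥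
      in subst (∣ x i ℚ.* y i ℚ.- x j ℚ.* y j ∣ ℚ.<_) total
           (product-close (x i) (y i) (x j) (y j) A>0 B>0
             (boundˣ i (⊔ˡ {K} {L} i≥KL)) (boundʸ j (⊔ʳ {K} {L} j≥KL))
             (closeˣ i j (⊔ˡ {M} {N} i≥MN) (⊔ˡ {M} {N} j≥MN))
             (closeʸ i j (⊔ʳ {M} {N} i≥MN) (⊔ʳ {M} {N} j≥MN)))

_+ℝ_ : ℝ → ℝ → ℝ
x +ℝ y = mkℝ (λ i → seq x i ℚ.+ seq y i) (+-cauchy {seq x} {seq y} (cauchy x) (cauchy y))

-ℝ_ : ℝ → ℝ
-ℝ x = mkℝ (λ i → ℚ.- seq x i) (neg-cauchy {seq x} (cauchy x))

_-ℝ_ : ℝ → ℝ → ℝ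
x -ℝ y = x +ℝ (-ℝ y)

_*ℝ_ : ℝ → ℝ → ℝ
x *ℝ y = mkℝ (λ i → seq x i ℚ.* seq y i) (*-cauchy {seq x} {seq y} (cauchy x) (cauchy y))

fromℚ : ℚ → ℝ
fromℚ q = mkℝ (λ _ → q) (const-cauchy q)

fromℕ : ℕ → ℝ
fromℕ n = fromℚ (+ n ℚ./ 1)

-- Since the order on ℝ is not decidable constructively, d₁(m,k) and d₂(m,k)
-- are not given as functions of a Cauchy sequence k but by their defining
-- properties.  They are unique, and for 1 ≤ k ≤ m they exist classically
-- (see `d₁-unique`, `d₂-unique` and `neighbours-exist` below).

record IsLargestDivisor≤ (m : ℕ) (k : ℝ) (d : ℕ) : Set where
  field
    divides : d ∣ m
    bound   : fromℕ d ≤ℝ k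
    largest : ∀ e → e ∣ m → fromℕ e ≤ℝ k → e ℕ.≤ d

record IsSmallestDivisor≥ (m : ℕ) (k : ℝ) (d : ℕ) : Set where
  field
    divides  : d ∣ m
    bound    : k ≤ℝ fromℕ d
    smallest : ∀ e → e ∣ m → k ≤ℝ fromℕ e → d ℕ.≤ e

record Neighbours (m : ℕ) (k : ℝ) : Set where
  field
    d₁    : ℕ
    d₂    : ℕ
    is-d₁ : IsLargestDivisor≤ m k d₁
    is-d₂ : IsSmallestDivisor≥ m k d₂

divisor-nonZero : ∀ {d m} .{{_ : NonZero m}} → d ∣ m → NonZero d
divisor-nonZero {zero}  {suc _} 0∣m with () ← 0∣⇒≡0 0∣m
divisor-nonZero {suc _} {suc _} _   = _

cofactor-nonZero : ∀ {d n} .{{_ : NonZero n}} .{{_ : NonZero d}} → d ∣ n → NonZero (n / d)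
cofactor-nonZero d∣n = subst NonZero (sym (n/m≡quotient d∣n)) (quotient≢0 d∣n)

u : (m : ℕ) .{{_ : NonZero m}} (k : ℝ) → Neighbours m k → ℝ
u m k N = fromℚ (+ m ℚ./ (d₁ ℕ.* d₂)) *ℝ (fromℕ d₁ +ℝ fromℕ d₂ -ℝ k)
  where
  open Neighbours N
  instance
    d₁d₂≢0 : NonZero (d₁ ℕ.* d₂)
    d₁d₂≢0 = ℕ.m*n≢0 d₁ d₂
      {{divisor-nonZero (IsLargestDivisor≤.divides is-d₁)}}
      {{divisor-nonZero (IsSmallestDivisor≥.divides is-d₂)}}

d₁-unique : ∀ {m k d d′} → IsLargestDivisor≤ m k d → IsLargestDivisor≤ m k d′ → d ≡ d′
d₁-unique p q = ℕ.≤-antisym (Q.largest _ P.divides P.bound) (P.largest _ Q.divides Q.bound)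
  where
  module P = IsLargestDivisor≤ p
  module Q = IsLargestDivisor≤ q

d₂-unique : ∀ {m k d d′} → IsSmallestDivisor≥ m k d → IsSmallestDivisor≥ m k d′ → d ≡ d′
d₂-unique p q = ℕ.≤-antisym (P.smallest _ Q.divides Q.bound) (Q.smallest _ P.divides P.bound)
  where
  module P = IsSmallestDivisor≥ p
  module Q = IsSmallestDivisor≥ q

private
  ¬¬-maximum : ∀ {P : ℕ → Set} {m} → (∀ e → P e → e ℕ.≤ m) →
    ∀ fuel a → m ℕ.≤ a ℕ.+ fuel → P a → ¬ ¬ (∃ λ d → P d × ∀ e → P e → e ℕ.≤ d)
  ¬¬-maximum {P} {m} ≤m fuel a m≤ pa none =
    none (a , pa , λ e pe → ℕ.≮⇒≥ (λ a<e → larger fuel m≤ e pe a<e))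
    where
    larger : ∀ fuel → m ℕ.≤ a ℕ.+ fuel → ∀ e → P e → ¬ (a ℕ.< e)
    larger zero m≤ e pe a<e =
      ℕ.<⇒≱ a<e (ℕ.≤-trans (≤m e pe) (subst (m ℕ.≤_) (ℕ.+-identityʳ a) m≤))
    larger (suc f) m≤ e pe a<e = ¬¬-maximum ≤m f e
      (ℕ.≤-trans m≤ (subst (ℕ._≤ e ℕ.+ f) (sym (ℕ.+-suc a f)) (ℕ.+-monoˡ-≤ f a<e))) pe none

  ¬¬-minimum : ∀ {P : ℕ → Set} fuel a → a ℕ.≤ fuel → P a →
    ¬ ¬ (∃ λ d → P d × ∀ e → P e → d ℕ.≤ e)
  ¬¬-minimum {P} fuel a a≤ pa none =
    none (a , pa , λ e pe → ℕ.≮⇒≥ (λ e<a → smaller fuel a≤ e pe e<a))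
    where
    smaller : ∀ fuel → a ℕ.≤ fuel → ∀ e → P e → ¬ (e ℕ.< a)
    smaller zero    a≤ e pe e<a = ℕ.n≮0 (ℕ.<-≤-trans e<a a≤)
    smaller (suc f) a≤ e pe e<a =
      ¬¬-minimum f e (ℕ.s≤s⁻¹ (ℕ.<-≤-trans e<a a≤)) pe none

neighbours-exist : ∀ m .{{_ : NonZero m}} k → fromℕ 1 ≤ℝ k → k ≤ℝ fromℕ m → ¬ ¬ Neighbours m k
neighbours-exist m k 1≤k k≤m none =
  ¬¬-maximum {λ e → e ∣ m × fromℕ e ≤ℝ k} (λ e (e∣m , _) → ∣⇒≤ e∣m)
    m 1 (ℕ.n≤1+n m) (1∣ m , 1≤k)
  λ (d₁ , (d₁∣m , d₁≤k) , max) →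
  ¬¬-minimum {λ e → e ∣ m × k ≤ℝ fromℕ e} m m ℕ.≤-refl (∣-refl , k≤m)
  λ (d₂ , (d₂∣m , k≤d₂) , min) →
  none record
    { d₁    = d₁
    ; d₂    = d₂
    ; is-d₁ = record { divides = d₁∣m ; bound = d₁≤k ; largest  = λ e p q → max e (p , q) }
    ; is-d₂ = record { divides = d₂∣m ; bound = k≤d₂ ; smallest = λ e p q → min e (p , q) }
    }

{-# OPTIONS --safe #-}
-- u(m, ·) interpolates m/k linearly between consecutive divisors of m, so by convexity
-- it lies below the chord of m/k through any two divisors x ≤ k ≤ y.  Let a₁ ≤ s ≤ a₂ and
-- b₁ ≤ t ≤ b₂ be the neighbouring divisors and assume a₁b₂ ≤ a₂b₁.  The divisors
-- a₁b₁ ≤ a₁b₂ ≤ a₂b₁ ≤ a₂b₂ of n enclose st in one of three ways, and with p = a₁ + a₂ − s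
-- and q = b₁ + b₂ − t the gap in the chord inequality is, up to a positive factor, one of
--   a₁pq − a₂(a₁b₁ + a₁b₂ − st) = (s − a₁)((a₂ + a₁)(t − b₁) + (a₂b₁ − a₁b₂)),
--   pq − (a₁b₂ + a₂b₁ − st)     = (a₂ − s)(b₂ − t) + (s − a₁)(t − b₁),
--   a₂pq − a₁(a₂b₁ + a₂b₂ − st) = (a₂ − s)((a₂ + a₁)(b₂ − t) + (a₂b₁ − a₁b₂)).

module Submission where

open import Defs
open import Data.Nat.Base using (ℕ; NonZero; _/_)
open import Data.Nat.Divisibility using (_∣_)

open import Data.Integer.Base as ℤ using (+_)
import Data.Integer.Properties as ℤ
import Data.Nat.Base as ℕ
import Data.Nat.Properties as ℕ
open import Data.Nat.Divisibility using (*-pres-∣)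
open import Data.Nat.DivMod using (m*[n/m]≡n)
open import Data.Product.Base using (_,_)
open import Data.Rational.Base as ℚ
  using (ℚ; 0ℚ; 1ℚ; ½; Positive; nonNegative; fromℚᵘ; ∣_∣)
import Data.Rational.Properties as ℚ
open import Data.Rational.Solver using (module +-*-Solver)
open import Data.Rational.Unnormalised.Base as ℚᵘ using (mkℚᵘ; *≡*)
import Data.Rational.Unnormalised.Properties as ℚᵘ
open import Data.Sum.Base using (_⊎_; inj₁; inj₂)
open import Relation.Binary.PropositionalEquality
  using (_≡_; refl; sym; trans; cong; cong₂; subst; subst₂)
open import Relation.Nullary.Decidable using (yes; no)
open import Relation.Nullary.Negation using (¬_; contradiction)

open +-*-Solver

≤-from-difference : ∀ {p q r s} → p ℚ.≤ q → q ℚ.- p ≡ s ℚ.- r → r ℚ.≤ s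
≤-from-difference {p} {q} {r} {s} p≤q eq = subst₂ ℚ._≤_ (left p r)
  (trans (right q p r) (trans (cong (ℚ._+ r) eq) (sym (right′ s r))))
  (ℚ.+-monoˡ-≤ (r ℚ.- p) p≤q)
  where
  left : ∀ p r → p ℚ.+ (r ℚ.- p) ≡ r
  left = solve 2 (λ p r → p :+ (r :- p) := r) refl
  right : ∀ q p r → q ℚ.+ (r ℚ.- p) ≡ (q ℚ.- p) ℚ.+ r
  right = solve 3 (λ q p r → q :+ (r :- p) := (q :- p) :+ r) refl
  right′ : ∀ s r → s ≡ (s ℚ.- r) ℚ.+ r
  right′ = solve 2 (λ s r → s := (s :- r) :+ r) refl

≤⇒0≤- : ∀ {p q} → p ℚ.≤ q → 0ℚ ℚ.≤ q ℚ.- p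
≤⇒0≤- {p} {q} p≤q = ≤-from-difference p≤q
  (solve 2 (λ p q → q :- p := (q :- p) :- con 0ℚ) refl p q)

0≤-+ : ∀ {p q} → 0ℚ ℚ.≤ p → 0ℚ ℚ.≤ q → 0ℚ ℚ.≤ p ℚ.+ q
0≤-+ = ℚ.+-mono-≤

0≤-* : ∀ {p q} → 0ℚ ℚ.≤ p → 0ℚ ℚ.≤ q → 0ℚ ℚ.≤ p ℚ.* q
0≤-* {p} {q} 0≤p 0≤q = ℚ.nonNegative⁻¹ (p ℚ.* q)
  {{ℚ.nonNeg*nonNeg⇒nonNeg p {{nonNegative 0≤p}} q {{nonNegative 0≤q}}}}

pos⇒0≤ : ∀ p → Positive p → 0ℚ ℚ.≤ p
pos⇒0≤ p p>0 = ℚ.<⇒≤ (ℚ.positive⁻¹ p {{p>0}})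

p≤∣p∣ : ∀ p → p ℚ.≤ ∣ p ∣
p≤∣p∣ p with ℚ.≤-total 0ℚ p
... | inj₁ 0≤p = ℚ.≤-reflexive (sym (ℚ.0≤p⇒∣p∣≡p 0≤p))
... | inj₂ p≤0 = ℚ.≤-trans p≤0 (ℚ.0≤∣p∣ p)

Nonneg : ℝ → Set
Nonneg x = fromℚ 0ℚ ≤ℝ x

nonneg-resp : ∀ {x y} → (∀ i → seq x i ≡ seq y i) → Nonneg x → Nonneg y
nonneg-resp x≗y 0≤x ε ε>0 with 0≤x ε ε>0
... | N , lower = N , λ i N≤i → subst (λ p → 0ℚ ℚ.≤ p ℚ.+ ε) (x≗y i) (lower i N≤i)

≤⇒nonneg : ∀ {x y} → x ≤ℝ y → Nonneg (y -ℝ x)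
≤⇒nonneg {x} {y} x≤y ε ε>0 with x≤y ε ε>0
... | N , upper = N , λ i N≤i → ≤-from-difference (upper i N≤i)
  (solve 3 (λ x y ε → (y :+ ε) :- x := ((y :- x) :+ ε) :- con 0ℚ) refl (seq x i) (seq y i) ε)

nonneg⇒≤ : ∀ {x y} → Nonneg (y -ℝ x) → x ≤ℝ y
nonneg⇒≤ {x} {y} 0≤y-x ε ε>0 with 0≤y-x ε ε>0
... | N , lower = N , λ i N≤i → ≤-from-difference (lower i N≤i)
  (solve 3 (λ x y ε → ((y :- x) :+ ε) :- con 0ℚ := (y :+ ε) :- x) refl (seq x i) (seq y i) ε)

nonneg-fromℚ : ∀ {q} → 0ℚ ℚ.≤ q → Nonneg (fromℚ q)
nonneg-fromℚ 0≤q ε ε>0 = 0 , λ _ _ → 0≤-+ 0≤q (pos⇒0≤ ε ε>0)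

nonneg-+ : ∀ {x y} → Nonneg x → Nonneg y → Nonneg (x +ℝ y)
nonneg-+ {x} {y} 0≤x 0≤y ε ε>0 with 0≤x (½ ℚ.* ε) (half ε ε>0) | 0≤y (½ ℚ.* ε) (half ε ε>0)
... | M , lowerˣ | N , lowerʸ = M ℕ.⊔ N , λ i i≥ →
  subst (0ℚ ℚ.≤_)
    (trans (solve 3 (λ x y h → (x :+ h) :+ (y :+ h) := (x :+ y) :+ (h :+ h)) refl
             (seq x i) (seq y i) (½ ℚ.* ε))
           (cong (λ e → seq x i ℚ.+ seq y i ℚ.+ e) (halves ε)))
    (0≤-+ (lowerˣ i (⊔ˡ i≥)) (lowerʸ i (⊔ʳ i≥)))

-- Each summand on the right is nonnegative:
-- xy + (A + B + 1)η = (x + δ)(y + δ) + δ(A − x) + δ(B − y) + (A + B + 1)(η − δ) + δ(1 − δ).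
product-lower : ∀ {x y A B δ η} → 0ℚ ℚ.≤ A → 0ℚ ℚ.≤ B → 0ℚ ℚ.≤ δ → δ ℚ.≤ 1ℚ → δ ℚ.≤ η →
  0ℚ ℚ.≤ x ℚ.+ δ → 0ℚ ℚ.≤ y ℚ.+ δ → x ℚ.≤ A → y ℚ.≤ B →
  0ℚ ℚ.≤ x ℚ.* y ℚ.+ (A ℚ.+ B ℚ.+ 1ℚ) ℚ.* η
product-lower {x} {y} {A} {B} {δ} {η} 0≤A 0≤B 0≤δ δ≤1 δ≤η 0≤x+δ 0≤y+δ x≤A y≤B =
  subst (0ℚ ℚ.≤_) (eq x y A B δ η)
    (0≤-+ (0≤-+ (0≤-+ (0≤-+ (0≤-* 0≤x+δ 0≤y+δ) (0≤-* 0≤δ (≤⇒0≤- x≤A)))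
      (0≤-* 0≤δ (≤⇒0≤- y≤B)))
      (0≤-* (0≤-+ (0≤-+ 0≤A 0≤B) (ℚ.nonNegative⁻¹ 1ℚ)) (≤⇒0≤- δ≤η)))
      (0≤-* 0≤δ (≤⇒0≤- δ≤1)))
  where
  eq : ∀ x y A B δ η →
    (x ℚ.+ δ) ℚ.* (y ℚ.+ δ) ℚ.+ δ ℚ.* (A ℚ.- x) ℚ.+ δ ℚ.* (B ℚ.- y)
      ℚ.+ (A ℚ.+ B ℚ.+ 1ℚ) ℚ.* (η ℚ.- δ) ℚ.+ δ ℚ.* (1ℚ ℚ.- δ)
    ≡ x ℚ.* y ℚ.+ (A ℚ.+ B ℚ.+ 1ℚ) ℚ.* η
  eq = solve 6 (λ x y A B δ η →
    (x :+ δ) :* (y :+ δ) :+ δ :* (A :- x) :+ δ :* (B :- y)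
      :+ (A :+ B :+ con 1ℚ) :* (η :- δ) :+ δ :* (con 1ℚ :- δ)
    := x :* y :+ (A :+ B :+ con 1ℚ) :* η) refl

⊓-pos : ∀ p q → Positive p → Positive q → Positive (p ℚ.⊓ q)
⊓-pos p q p>0 q>0 with ℚ.⊓-sel p q
... | inj₁ eq = subst Positive (sym eq) p>0
... | inj₂ eq = subst Positive (sym eq) q>0

nonneg-* : ∀ {x y} → Nonneg x → Nonneg y → Nonneg (x *ℝ y)
nonneg-* {x} {y} 0≤x 0≤y ε ε>0 =
  let A , A>0 , K , boundˣ = eventually-bounded {seq x} (cauchy x)
      B , B>0 , L , boundʸ = eventually-bounded {seq y} (cauchy y)
      A+B>0                = ℚ.pos+pos⇒pos A {{A>0}} B {{B>0}}
      C>0                  = ℚ.pos+pos⇒pos (A ℚ.+ B) {{A+B>0}} 1ℚ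
      η , η>0 , total      = divide (A ℚ.+ B ℚ.+ 1ℚ) C>0 ε ε>0
      δ                    = η ℚ.⊓ 1ℚ
      δ>0                  = ⊓-pos η 1ℚ η>0 _
      M , lowerˣ           = 0≤x δ δ>0
      N , lowerʸ           = 0≤y δ δ>0
  in (K ℕ.⊔ L) ℕ.⊔ (M ℕ.⊔ N) , λ i i≥ →
    let i≥KL = ⊔ˡ {K ℕ.⊔ L} {M ℕ.⊔ N} i≥
        i≥MN = ⊔ʳ {K ℕ.⊔ L} {M ℕ.⊔ N} i≥
    in subst (λ e → 0ℚ ℚ.≤ seq x i ℚ.* seq y i ℚ.+ e) total
         (product-lower {seq x i} {seq y i} {A} {B} {δ} {η} (pos⇒0≤ A A>0) (pos⇒0≤ B B>0) (pos⇒0≤ δ δ>0)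
           (ℚ.p⊓q≤q η 1ℚ) (ℚ.p⊓q≤p η 1ℚ)
           (lowerˣ i (⊔ˡ {M} {N} i≥MN)) (lowerʸ i (⊔ʳ {M} {N} i≥MN))
           (ℚ.≤-trans (p≤∣p∣ (seq x i)) (boundˣ i (⊔ˡ {K} {L} i≥KL)))
           (ℚ.≤-trans (p≤∣p∣ (seq y i)) (boundʸ i (⊔ʳ {K} {L} i≥KL))))

≤ℝ-resp : ∀ {x x′ y y′} → (∀ i → seq x i ≡ seq x′ i) → (∀ i → seq y i ≡ seq y′ i) →
  x ≤ℝ y → x′ ≤ℝ y′
≤ℝ-resp x≗x′ y≗y′ x≤y ε ε>0 with x≤y ε ε>0
... | N , upper = N , λ i N≤i →
  subst₂ (λ p q → p ℚ.≤ q ℚ.+ ε) (x≗x′ i) (y≗y′ i) (upper i N≤i)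

≤ℝ-trans : ∀ {x y z} → x ≤ℝ y → y ≤ℝ z → x ≤ℝ z
≤ℝ-trans {x} {y} {z} x≤y y≤z = nonneg⇒≤ {x} {z} (nonneg-resp {(y -ℝ x) +ℝ (z -ℝ y)} {z -ℝ x}
  (λ i → solve 3 (λ x y z → (y :- x) :+ (z :- y) := z :- x) refl (seq x i) (seq y i) (seq z i))
  (nonneg-+ {y -ℝ x} {z -ℝ y} (≤⇒nonneg {x} {y} x≤y) (≤⇒nonneg {y} {z} y≤z)))

-- A term xN within ε/2 of all later ones decides: xN ≤ ε/2 bounds these by ε, while xN > ε/2
-- makes them positive and so contradicts the hypothesis.
¬nonneg⇒neg-nonneg : ∀ {x} → ¬ Nonneg x → Nonneg (-ℝ x)
¬nonneg⇒neg-nonneg {x} ¬0≤x ε ε>0 with cauchy x (½ ℚ.* ε) (half ε ε>0)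
... | N , close with seq x N ℚ.≤? ½ ℚ.* ε
... | yes xN≤ = N , λ i N≤i →
  ≤-from-difference
    (ℚ.+-mono-≤ (ℚ.≤-trans (p≤∣p∣ (seq x i ℚ.- seq x N)) (ℚ.<⇒≤ (close i N N≤i ℕ.≤-refl))) xN≤)
    (trans (cong (ℚ._- (seq x i ℚ.- seq x N ℚ.+ seq x N)) (halves ε))
      (solve 3 (λ xi xN e → e :- (xi :- xN :+ xN) := (:- xi :+ e) :- con 0ℚ) refl
        (seq x i) (seq x N) ε))
... | no xN≰ = contradiction
  (λ ε′ ε′>0 → N , λ i N≤i → 0≤-+ {seq x i} {ε′}
    (≤-from-difference
      (ℚ.+-mono-≤ (ℚ.≤-trans (p≤∣p∣ (seq x N ℚ.- seq x i)) (ℚ.<⇒≤ (close N i ℕ.≤-refl N≤i)))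
                  (ℚ.<⇒≤ (ℚ.≰⇒> xN≰)))
      (solve 3 (λ xi xN h → (h :+ xN) :- (xN :- xi :+ h) := xi :- con 0ℚ) refl
        (seq x i) (seq x N) (½ ℚ.* ε)))
    (pos⇒0≤ ε′ ε′>0))
  ¬0≤x

≰ℝ⇒≥ℝ : ∀ {x y} → ¬ (x ≤ℝ y) → y ≤ℝ x
≰ℝ⇒≥ℝ {x} {y} x≰y = nonneg⇒≤ {y} {x} (nonneg-resp { -ℝ (y -ℝ x)} {x -ℝ y}
  (λ i → solve 2 (λ x y → :- (y :- x) := x :- y) refl (seq x i) (seq y i))
  (¬nonneg⇒neg-nonneg {y -ℝ x} (λ 0≤y-x → x≰y (nonneg⇒≤ {x} {y} 0≤y-x))))

nonneg-cancel : ∀ {κ x} → Positive κ → Nonneg (fromℚ κ *ℝ x) → Nonneg x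
nonneg-cancel {κ} {x} κ>0 0≤κx =
  let κ⁻¹ , κ⁻¹>0 , inverse = divide κ κ>0 1ℚ _
  in nonneg-resp {fromℚ κ⁻¹ *ℝ (fromℚ κ *ℝ x)} {x}
       (λ i → trans (solve 3 (λ k l x → l :* (k :* x) := (k :* l) :* x) refl κ κ⁻¹ (seq x i))
                (trans (cong (ℚ._* seq x i) inverse) (ℚ.*-identityˡ (seq x i))))
       (nonneg-* {fromℚ κ⁻¹} {fromℚ κ *ℝ x}
         (nonneg-fromℚ (pos⇒0≤ κ⁻¹ κ⁻¹>0)) 0≤κx)

*-cancel-≤ℝ : ∀ {κ ρ σ x y} → Positive κ → ρ ℚ.* κ ≡ σ →
  Nonneg (fromℚ κ *ℝ y -ℝ fromℚ σ *ℝ x) → fromℚ ρ *ℝ x ≤ℝ y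
*-cancel-≤ℝ {κ} {ρ} {σ} {x} {y} κ>0 refl 0≤ = nonneg⇒≤ {fromℚ ρ *ℝ x} {y}
  (nonneg-cancel {κ} {y -ℝ fromℚ ρ *ℝ x} κ>0
    (nonneg-resp {fromℚ κ *ℝ y -ℝ fromℚ σ *ℝ x} {fromℚ κ *ℝ (y -ℝ fromℚ ρ *ℝ x)}
      (λ i → solve 4 (λ k r x y → k :* y :- (r :* k) :* x := k :* (y :- r :* x)) refl
        κ ρ (seq x i) (seq y i))
      0≤))

ι : ℕ → ℚ
ι n = + n ℚ./ 1

fromℚᵘ-homo-* : ∀ p q → fromℚᵘ p ℚ.* fromℚᵘ q ≡ fromℚᵘ (p ℚᵘ.* q)
fromℚᵘ-homo-* p q = ℚ.toℚᵘ-injective (ℚᵘ.≃-trans (ℚ.toℚᵘ-homo-* (fromℚᵘ p) (fromℚᵘ q))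
  (ℚᵘ.≃-trans (ℚᵘ.*-cong (ℚ.toℚᵘ-fromℚᵘ p) (ℚ.toℚᵘ-fromℚᵘ q))
    (ℚᵘ.≃-sym (ℚ.toℚᵘ-fromℚᵘ (p ℚᵘ.* q)))))

ι-* : ∀ m n → ι (m ℕ.* n) ≡ ι m ℚ.* ι n
ι-* m n = sym (trans (fromℚᵘ-homo-* (mkℚᵘ (+ m) 0) (mkℚᵘ (+ n) 0))
  (cong (λ i → fromℚᵘ (mkℚᵘ i 0)) (sym (ℤ.pos-* m n))))

/-*-cancel : ∀ m q .{{_ : NonZero q}} → (+ m ℚ./ q) ℚ.* ι q ≡ ι m
/-*-cancel m q@(ℕ.suc q-1) = trans (fromℚᵘ-homo-* (mkℚᵘ (+ m) q-1) (mkℚᵘ (+ q) 0))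
  (ℚ.fromℚᵘ-cong {mkℚᵘ (+ m) q-1 ℚᵘ.* mkℚᵘ (+ q) 0} {mkℚᵘ (+ m) 0}
    (*≡* (trans (ℤ.*-identityʳ (+ m ℤ.* + q))
      (cong (λ i → + m ℤ.* + i) (sym (ℕ.*-identityʳ q))))))

/-nonneg : ∀ m q .{{_ : NonZero q}} → 0ℚ ℚ.≤ + m ℚ./ q
/-nonneg m q = ℚ.nonNegative⁻¹ (+ m ℚ./ q) {{ℚ.normalize-nonNeg m q}}

ι-pos : ∀ n .{{_ : NonZero n}} → Positive (ι n)
ι-pos n@(ℕ.suc _) = ℚ.normalize-pos n 1

ι-mono : ∀ {m n} → m ℕ.≤ n → ι m ℚ.≤ ι n
ι-mono {m} {n} m≤n = ℚ.toℚᵘ-cancel-≤ (ℚᵘ.≤-respˡ-≃ (ℚᵘ.≃-sym (ℚ.toℚᵘ-fromℚᵘ (mkℚᵘ (+ m) 0)))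
  (ℚᵘ.≤-respʳ-≃ (ℚᵘ.≃-sym (ℚ.toℚᵘ-fromℚᵘ (mkℚᵘ (+ n) 0)))
    (ℚᵘ.*≤* (ℤ.*-monoʳ-≤-nonNeg (+ 1) (ℤ.+≤+ m≤n)))))

chord : ℚ → ℚ → ℚ → ℝ → ℝ
chord ρ x y k = fromℚ ρ *ℝ (fromℚ x +ℝ fromℚ y -ℝ k)

chord-swap : ∀ ρ x y k i → seq (chord ρ x y k) i ≡ seq (chord ρ y x k) i
chord-swap ρ x y k i =
  solve 4 (λ r x y k → r :* (x :+ y :- k) := r :* (y :+ x :- k)) refl ρ x y (seq k i)

chord-compare : ∀ {ρ ρ′ c x y k} → Positive c → Positive y → 0ℚ ℚ.≤ ρ′ →
  ρ ℚ.* (c ℚ.* y) ≡ ρ′ ℚ.* (x ℚ.* y) → Nonneg ((fromℚ c -ℝ fromℚ x) *ℝ (fromℚ y -ℝ k)) →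
  chord ρ c y k ≤ℝ chord ρ′ x y k
chord-compare {ρ} {ρ′} {c} {x} {y} {k} c>0 y>0 0≤ρ′ eq 0≤ =
  *-cancel-≤ℝ {c ℚ.* y} {ρ} {ρ′ ℚ.* (x ℚ.* y)} {fromℚ c +ℝ fromℚ y -ℝ k} {chord ρ′ x y k}
    (ℚ.pos*pos⇒pos c {{c>0}} y {{y>0}}) eq
    (nonneg-resp
      {fromℚ (ρ′ ℚ.* y) *ℝ ((fromℚ c -ℝ fromℚ x) *ℝ (fromℚ y -ℝ k))}
      {fromℚ (c ℚ.* y) *ℝ chord ρ′ x y k -ℝ
        fromℚ (ρ′ ℚ.* (x ℚ.* y)) *ℝ (fromℚ c +ℝ fromℚ y -ℝ k)}
      (λ i → solve 5 (λ r c x y k →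
          (r :* y) :* ((c :- x) :* (y :- k)) :=
          (c :* y) :* (r :* (x :+ y :- k)) :- (r :* (x :* y)) :* (c :+ y :- k))
        refl ρ′ c x y (seq k i))
      (nonneg-* {fromℚ (ρ′ ℚ.* y)} {(fromℚ c -ℝ fromℚ x) *ℝ (fromℚ y -ℝ k)}
        (nonneg-fromℚ (0≤-* 0≤ρ′ (pos⇒0≤ y y>0))) 0≤))

chord-widen : ∀ {ρ ρ′ ρ″ x y c₁ c₂ k} → Positive c₁ → Positive c₂ → Positive x →
  0ℚ ℚ.≤ ρ′ → 0ℚ ℚ.≤ ρ″ →
  ρ ℚ.* (c₁ ℚ.* c₂) ≡ ρ′ ℚ.* (x ℚ.* c₂) → ρ′ ℚ.* (x ℚ.* c₂) ≡ ρ″ ℚ.* (x ℚ.* y) →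
  x ℚ.≤ c₁ → c₂ ℚ.≤ y → fromℚ c₁ ≤ℝ k → k ≤ℝ fromℚ c₂ →
  chord ρ c₁ c₂ k ≤ℝ chord ρ″ x y k
chord-widen {ρ} {ρ′} {ρ″} {x} {y} {c₁} {c₂} {k}
  c₁>0 c₂>0 x>0 0≤ρ′ 0≤ρ″ eq₁ eq₂ x≤c₁ c₂≤y c₁≤k k≤c₂ =
  ≤ℝ-trans {chord ρ c₁ c₂ k} {chord ρ′ x c₂ k} {chord ρ″ x y k}
    (chord-compare {ρ} {ρ′} {c₁} {x} {c₂} {k} c₁>0 c₂>0 0≤ρ′ eq₁
      (nonneg-* {fromℚ c₁ -ℝ fromℚ x} {fromℚ c₂ -ℝ k}
        (nonneg-fromℚ (≤⇒0≤- x≤c₁)) (≤⇒nonneg {k} {fromℚ c₂} k≤c₂)))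
    (≤ℝ-resp {chord ρ′ c₂ x k} {chord ρ′ x c₂ k} {chord ρ″ y x k} {chord ρ″ x y k}
      (chord-swap ρ′ c₂ x k) (chord-swap ρ″ y x k)
      (chord-compare {ρ′} {ρ″} {c₂} {y} {x} {k} c₂>0 x>0 0≤ρ″
        (trans (cong (ρ′ ℚ.*_) (ℚ.*-comm c₂ x)) (trans eq₂ (cong (ρ″ ℚ.*_) (ℚ.*-comm x y))))
        (nonneg-resp {(fromℚ y -ℝ fromℚ c₂) *ℝ (k -ℝ fromℚ x)}
          {(fromℚ c₂ -ℝ fromℚ y) *ℝ (fromℚ x -ℝ k)}
          (λ i → solve 4 (λ x y c k → (y :- c) :* (k :- x) := (c :- y) :* (x :- k)) refl
            x y c₂ (seq k i))
          (nonneg-* {fromℚ y -ℝ fromℚ c₂} {k -ℝ fromℚ x}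
            (nonneg-fromℚ (≤⇒0≤- c₂≤y))
            (≤⇒nonneg {fromℚ x} {k} (≤ℝ-trans {fromℚ x} {fromℚ c₁} {k}
              (nonneg⇒≤ {fromℚ x} {fromℚ c₁} (nonneg-fromℚ (≤⇒0≤- x≤c₁))) c₁≤k))))))

module ChordProduct {ρ₁ ρ₂ a₁ a₂ b₁ b₂ : ℚ} {s t : ℝ}
  (0≤ρ₁ : 0ℚ ℚ.≤ ρ₁) (0≤ρ₂ : 0ℚ ℚ.≤ ρ₂)
  (a₁>0 : Positive a₁) (a₂>0 : Positive a₂) (b₁>0 : Positive b₁) (b₂>0 : Positive b₂)
  (a₁≤s : fromℚ a₁ ≤ℝ s) (s≤a₂ : s ≤ℝ fromℚ a₂) (b₁≤t : fromℚ b₁ ≤ℝ t) (t≤b₂ : t ≤ℝ fromℚ b₂)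
  where

  private
    0≤s-a₁ : Nonneg (s -ℝ fromℚ a₁)
    0≤s-a₁ = ≤⇒nonneg {fromℚ a₁} {s} a₁≤s
    0≤a₂-s : Nonneg (fromℚ a₂ -ℝ s)
    0≤a₂-s = ≤⇒nonneg {s} {fromℚ a₂} s≤a₂
    0≤t-b₁ : Nonneg (t -ℝ fromℚ b₁)
    0≤t-b₁ = ≤⇒nonneg {fromℚ b₁} {t} b₁≤t
    0≤b₂-t : Nonneg (fromℚ b₂ -ℝ t)
    0≤b₂-t = ≤⇒nonneg {t} {fromℚ b₂} t≤b₂

    pos-* : ∀ p q → Positive p → Positive q → Positive (p ℚ.* q)
    pos-* p q p>0 q>0 = ℚ.pos*pos⇒pos p {{p>0}} q {{q>0}}

    0≤a₁ : 0ℚ ℚ.≤ a₁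
    0≤a₁ = pos⇒0≤ a₁ a₁>0
    0≤a₂ : 0ℚ ℚ.≤ a₂
    0≤a₂ = pos⇒0≤ a₂ a₂>0
    0≤b₁ : 0ℚ ℚ.≤ b₁
    0≤b₁ = pos⇒0≤ b₁ b₁>0
    0≤b₂ : 0ℚ ℚ.≤ b₂
    0≤b₂ = pos⇒0≤ b₂ b₂>0

    σ : ℚ
    σ = (ρ₁ ℚ.* (a₁ ℚ.* a₂)) ℚ.* (ρ₂ ℚ.* (b₁ ℚ.* b₂))

    product : ℝ
    product = chord ρ₁ a₁ a₂ s *ℝ chord ρ₂ b₁ b₂ t

    chord-≤-product : ∀ {ρ x y τ z} → Positive (x ℚ.* y) → ρ ℚ.* (x ℚ.* y) ≡ σ →
      0ℚ ℚ.≤ τ → Nonneg z →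
      (∀ i → seq (fromℚ τ *ℝ z) i ≡
        seq (fromℚ (x ℚ.* y) *ℝ product -ℝ fromℚ σ *ℝ (fromℚ x +ℝ fromℚ y -ℝ s *ℝ t)) i) →
      chord ρ x y (s *ℝ t) ≤ℝ product
    chord-≤-product {ρ} {x} {y} {τ} {z} xy>0 eq 0≤τ 0≤z identity =
      *-cancel-≤ℝ {x ℚ.* y} {ρ} {σ} {fromℚ x +ℝ fromℚ y -ℝ s *ℝ t} {product} xy>0 eq
        (nonneg-resp {fromℚ τ *ℝ z}
          {fromℚ (x ℚ.* y) *ℝ product -ℝ fromℚ σ *ℝ (fromℚ x +ℝ fromℚ y -ℝ s *ℝ t)}
          identity (nonneg-* {fromℚ τ} {z} (nonneg-fromℚ 0≤τ) 0≤z))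

  a₁b₁≤st : fromℚ (a₁ ℚ.* b₁) ≤ℝ s *ℝ t
  a₁b₁≤st = nonneg⇒≤ {fromℚ (a₁ ℚ.* b₁)} {s *ℝ t}
    (nonneg-resp
      {(s -ℝ fromℚ a₁) *ℝ (t -ℝ fromℚ b₁) +ℝ
        (fromℚ b₁ *ℝ (s -ℝ fromℚ a₁) +ℝ fromℚ a₁ *ℝ (t -ℝ fromℚ b₁))}
      {s *ℝ t -ℝ fromℚ (a₁ ℚ.* b₁)}
      (λ i → solve 4 (λ a b s t →
          (s :- a) :* (t :- b) :+ (b :* (s :- a) :+ a :* (t :- b)) := s :* t :- a :* b)
        refl a₁ b₁ (seq s i) (seq t i))
      (nonneg-+ {(s -ℝ fromℚ a₁) *ℝ (t -ℝ fromℚ b₁)}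
        {fromℚ b₁ *ℝ (s -ℝ fromℚ a₁) +ℝ fromℚ a₁ *ℝ (t -ℝ fromℚ b₁)}
        (nonneg-* {s -ℝ fromℚ a₁} {t -ℝ fromℚ b₁} 0≤s-a₁ 0≤t-b₁)
        (nonneg-+ {fromℚ b₁ *ℝ (s -ℝ fromℚ a₁)} {fromℚ a₁ *ℝ (t -ℝ fromℚ b₁)}
          (nonneg-* {fromℚ b₁} {s -ℝ fromℚ a₁} (nonneg-fromℚ 0≤b₁) 0≤s-a₁)
          (nonneg-* {fromℚ a₁} {t -ℝ fromℚ b₁} (nonneg-fromℚ 0≤a₁) 0≤t-b₁))))

  st≤a₂b₂ : s *ℝ t ≤ℝ fromℚ (a₂ ℚ.* b₂)
  st≤a₂b₂ = nonneg⇒≤ {s *ℝ t} {fromℚ (a₂ ℚ.* b₂)}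
    (nonneg-resp
      {(fromℚ a₂ -ℝ s) *ℝ (t -ℝ fromℚ b₁) +ℝ
        (fromℚ b₁ *ℝ (fromℚ a₂ -ℝ s) +ℝ fromℚ a₂ *ℝ (fromℚ b₂ -ℝ t))}
      {fromℚ (a₂ ℚ.* b₂) -ℝ s *ℝ t}
      (λ i → solve 5 (λ a b b′ s t →
          (a :- s) :* (t :- b) :+ (b :* (a :- s) :+ a :* (b′ :- t)) := a :* b′ :- s :* t)
        refl a₂ b₁ b₂ (seq s i) (seq t i))
      (nonneg-+ {(fromℚ a₂ -ℝ s) *ℝ (t -ℝ fromℚ b₁)}
        {fromℚ b₁ *ℝ (fromℚ a₂ -ℝ s) +ℝ fromℚ a₂ *ℝ (fromℚ b₂ -ℝ t)}
        (nonneg-* {fromℚ a₂ -ℝ s} {t -ℝ fromℚ b₁} 0≤a₂-s 0≤t-b₁)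
        (nonneg-+ {fromℚ b₁ *ℝ (fromℚ a₂ -ℝ s)} {fromℚ a₂ *ℝ (fromℚ b₂ -ℝ t)}
          (nonneg-* {fromℚ b₁} {fromℚ a₂ -ℝ s} (nonneg-fromℚ 0≤b₁) 0≤a₂-s)
          (nonneg-* {fromℚ a₂} {fromℚ b₂ -ℝ t} (nonneg-fromℚ 0≤a₂) 0≤b₂-t))))

  low-≤-product : ∀ {ρ} → a₁ ℚ.* b₂ ℚ.≤ a₂ ℚ.* b₁ →
    ρ ℚ.* ((a₁ ℚ.* b₁) ℚ.* (a₁ ℚ.* b₂)) ≡ σ →
    chord ρ (a₁ ℚ.* b₁) (a₁ ℚ.* b₂) (s *ℝ t) ≤ℝ product
  low-≤-product {ρ} a₁b₂≤a₂b₁ eq =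
    chord-≤-product {ρ} {a₁ ℚ.* b₁} {a₁ ℚ.* b₂} {ρ₁ ℚ.* ρ₂ ℚ.* (a₁ ℚ.* b₁ ℚ.* b₂)}
      {(s -ℝ fromℚ a₁) *ℝ
        (fromℚ (a₂ ℚ.+ a₁) *ℝ (t -ℝ fromℚ b₁) +ℝ fromℚ (a₂ ℚ.* b₁ ℚ.- a₁ ℚ.* b₂))}
      (pos-* (a₁ ℚ.* b₁) (a₁ ℚ.* b₂) (pos-* a₁ b₁ a₁>0 b₁>0) (pos-* a₁ b₂ a₁>0 b₂>0)) eq
      (0≤-* (0≤-* 0≤ρ₁ 0≤ρ₂) (0≤-* (0≤-* 0≤a₁ 0≤b₁) 0≤b₂))
      (nonneg-* {s -ℝ fromℚ a₁}
        {fromℚ (a₂ ℚ.+ a₁) *ℝ (t -ℝ fromℚ b₁) +ℝ fromℚ (a₂ ℚ.* b₁ ℚ.- a₁ ℚ.* b₂)}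
        0≤s-a₁
        (nonneg-+ {fromℚ (a₂ ℚ.+ a₁) *ℝ (t -ℝ fromℚ b₁)} {fromℚ (a₂ ℚ.* b₁ ℚ.- a₁ ℚ.* b₂)}
          (nonneg-* {fromℚ (a₂ ℚ.+ a₁)} {t -ℝ fromℚ b₁} (nonneg-fromℚ (0≤-+ {a₂} {a₁} 0≤a₂ 0≤a₁)) 0≤t-b₁)
          (nonneg-fromℚ (≤⇒0≤- a₁b₂≤a₂b₁))))
      (λ i → solve 8 (λ r₁ r₂ a₁ a₂ b₁ b₂ s t →
          (r₁ :* r₂ :* (a₁ :* b₁ :* b₂)) :*
            ((s :- a₁) :* ((a₂ :+ a₁) :* (t :- b₁) :+ (a₂ :* b₁ :- a₁ :* b₂))) :=
          ((a₁ :* b₁) :* (a₁ :* b₂)) :*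
            ((r₁ :* (a₁ :+ a₂ :- s)) :* (r₂ :* (b₁ :+ b₂ :- t))) :-
          ((r₁ :* (a₁ :* a₂)) :* (r₂ :* (b₁ :* b₂))) :* (a₁ :* b₁ :+ a₁ :* b₂ :- s :* t))
        refl ρ₁ ρ₂ a₁ a₂ b₁ b₂ (seq s i) (seq t i))

  middle-≤-product : ∀ {ρ} → ρ ℚ.* ((a₁ ℚ.* b₂) ℚ.* (a₂ ℚ.* b₁)) ≡ σ →
    chord ρ (a₁ ℚ.* b₂) (a₂ ℚ.* b₁) (s *ℝ t) ≤ℝ product
  middle-≤-product {ρ} eq =
    chord-≤-product {ρ} {a₁ ℚ.* b₂} {a₂ ℚ.* b₁} {σ}
      {(fromℚ a₂ -ℝ s) *ℝ (fromℚ b₂ -ℝ t) +ℝ (s -ℝ fromℚ a₁) *ℝ (t -ℝ fromℚ b₁)}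
      (pos-* (a₁ ℚ.* b₂) (a₂ ℚ.* b₁) (pos-* a₁ b₂ a₁>0 b₂>0) (pos-* a₂ b₁ a₂>0 b₁>0)) eq
      (0≤-* (0≤-* 0≤ρ₁ (0≤-* 0≤a₁ 0≤a₂)) (0≤-* 0≤ρ₂ (0≤-* 0≤b₁ 0≤b₂)))
      (nonneg-+ {(fromℚ a₂ -ℝ s) *ℝ (fromℚ b₂ -ℝ t)} {(s -ℝ fromℚ a₁) *ℝ (t -ℝ fromℚ b₁)}
        (nonneg-* {fromℚ a₂ -ℝ s} {fromℚ b₂ -ℝ t} 0≤a₂-s 0≤b₂-t)
        (nonneg-* {s -ℝ fromℚ a₁} {t -ℝ fromℚ b₁} 0≤s-a₁ 0≤t-b₁))
      (λ i → solve 8 (λ r₁ r₂ a₁ a₂ b₁ b₂ s t →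
          ((r₁ :* (a₁ :* a₂)) :* (r₂ :* (b₁ :* b₂))) :*
            ((a₂ :- s) :* (b₂ :- t) :+ (s :- a₁) :* (t :- b₁)) :=
          ((a₁ :* b₂) :* (a₂ :* b₁)) :*
            ((r₁ :* (a₁ :+ a₂ :- s)) :* (r₂ :* (b₁ :+ b₂ :- t))) :-
          ((r₁ :* (a₁ :* a₂)) :* (r₂ :* (b₁ :* b₂))) :* (a₁ :* b₂ :+ a₂ :* b₁ :- s :* t))
        refl ρ₁ ρ₂ a₁ a₂ b₁ b₂ (seq s i) (seq t i))

  high-≤-product : ∀ {ρ} → a₁ ℚ.* b₂ ℚ.≤ a₂ ℚ.* b₁ →
    ρ ℚ.* ((a₂ ℚ.* b₁) ℚ.* (a₂ ℚ.* b₂)) ≡ σ →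
    chord ρ (a₂ ℚ.* b₁) (a₂ ℚ.* b₂) (s *ℝ t) ≤ℝ product
  high-≤-product {ρ} a₁b₂≤a₂b₁ eq =
    chord-≤-product {ρ} {a₂ ℚ.* b₁} {a₂ ℚ.* b₂} {ρ₁ ℚ.* ρ₂ ℚ.* (a₂ ℚ.* b₁ ℚ.* b₂)}
      {(fromℚ a₂ -ℝ s) *ℝ
        (fromℚ (a₂ ℚ.+ a₁) *ℝ (fromℚ b₂ -ℝ t) +ℝ fromℚ (a₂ ℚ.* b₁ ℚ.- a₁ ℚ.* b₂))}
      (pos-* (a₂ ℚ.* b₁) (a₂ ℚ.* b₂) (pos-* a₂ b₁ a₂>0 b₁>0) (pos-* a₂ b₂ a₂>0 b₂>0)) eq
      (0≤-* (0≤-* 0≤ρ₁ 0≤ρ₂) (0≤-* (0≤-* 0≤a₂ 0≤b₁) 0≤b₂))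
      (nonneg-* {fromℚ a₂ -ℝ s}
        {fromℚ (a₂ ℚ.+ a₁) *ℝ (fromℚ b₂ -ℝ t) +ℝ fromℚ (a₂ ℚ.* b₁ ℚ.- a₁ ℚ.* b₂)}
        0≤a₂-s
        (nonneg-+ {fromℚ (a₂ ℚ.+ a₁) *ℝ (fromℚ b₂ -ℝ t)} {fromℚ (a₂ ℚ.* b₁ ℚ.- a₁ ℚ.* b₂)}
          (nonneg-* {fromℚ (a₂ ℚ.+ a₁)} {fromℚ b₂ -ℝ t} (nonneg-fromℚ (0≤-+ {a₂} {a₁} 0≤a₂ 0≤a₁)) 0≤b₂-t)
          (nonneg-fromℚ (≤⇒0≤- a₁b₂≤a₂b₁))))
      (λ i → solve 8 (λ r₁ r₂ a₁ a₂ b₁ b₂ s t →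
          (r₁ :* r₂ :* (a₂ :* b₁ :* b₂)) :*
            ((a₂ :- s) :* ((a₂ :+ a₁) :* (b₂ :- t) :+ (a₂ :* b₁ :- a₁ :* b₂))) :=
          ((a₂ :* b₁) :* (a₂ :* b₂)) :*
            ((r₁ :* (a₁ :+ a₂ :- s)) :* (r₂ :* (b₁ :+ b₂ :- t))) :-
          ((r₁ :* (a₁ :* a₂)) :* (r₂ :* (b₁ :* b₂))) :* (a₂ :* b₁ :+ a₂ :* b₂ :- s :* t))
        refl ρ₁ ρ₂ a₁ a₂ b₁ b₂ (seq s i) (seq t i))

divisorChord : (m x y : ℕ) .{{_ : NonZero x}} .{{_ : NonZero y}} → ℝ → ℝ
divisorChord m x y = chord ((+ m ℚ./ (x ℕ.* y)) {{ℕ.m*n≢0 x y}}) (ι x) (ι y)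

/-*-*-cancel : ∀ m x y .{{_ : NonZero (x ℕ.* y)}} →
  (+ m ℚ./ (x ℕ.* y)) ℚ.* (ι x ℚ.* ι y) ≡ ι m
/-*-*-cancel m x y =
  trans (cong ((+ m ℚ./ (x ℕ.* y)) ℚ.*_) (sym (ι-* x y))) (/-*-cancel m (x ℕ.* y))

module _ {m : ℕ} {k : ℝ} .{{_ : NonZero m}} (N : Neighbours m k) where
  open Neighbours N
  private
    module L = IsLargestDivisor≤ is-d₁
    module S = IsSmallestDivisor≥ is-d₂

    instance
      d₁≢0 : NonZero d₁
      d₁≢0 = divisor-nonZero L.divides
      d₂≢0 : NonZero d₂
      d₂≢0 = divisor-nonZero S.divides

  divisor-outside : ∀ {x} → x ∣ m → x ℕ.≤ d₁ ⊎ d₂ ℕ.≤ x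
  divisor-outside {x} x∣m with x ℕ.≤? d₁
  ... | yes x≤d₁ = inj₁ x≤d₁
  ... | no  x≰d₁ = inj₂ (S.smallest x x∣m
    (≰ℝ⇒≥ℝ {fromℕ x} {k} (λ x≤k → x≰d₁ (L.largest x x∣m x≤k))))

  u-≤-divisorChord : ∀ x y .{{_ : NonZero x}} .{{_ : NonZero y}} →
    x ℕ.≤ d₁ → d₂ ℕ.≤ y → u m k N ≤ℝ divisorChord m x y k
  u-≤-divisorChord x y x≤d₁ d₂≤y = chord-widen
    {+ m ℚ./ (d₁ ℕ.* d₂)} {+ m ℚ./ (x ℕ.* d₂)} {+ m ℚ./ (x ℕ.* y)}
    {ι x} {ι y} {ι d₁} {ι d₂} {k}
    (ι-pos d₁) (ι-pos d₂) (ι-pos x) (/-nonneg m (x ℕ.* d₂)) (/-nonneg m (x ℕ.* y))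
    (trans (/-*-*-cancel m d₁ d₂) (sym (/-*-*-cancel m x d₂)))
    (trans (/-*-*-cancel m x d₂) (sym (/-*-*-cancel m x y)))
    (ι-mono x≤d₁) (ι-mono d₂≤y) L.bound S.bound
    where
    instance
      d₁d₂≢0 : NonZero (d₁ ℕ.* d₂)
      d₁d₂≢0 = ℕ.m*n≢0 d₁ d₂
      xd₂≢0 : NonZero (x ℕ.* d₂)
      xd₂≢0 = ℕ.m*n≢0 x d₂
      xy≢0 : NonZero (x ℕ.* y)
      xy≢0 = ℕ.m*n≢0 x y

-- The hypothesis on k, rather than k = s *ℝ t, lets the roles of (d , s) and (e , t) be exchanged.
u-submultiplicative : ∀ {n d e} .{{_ : NonZero n}} .{{d≢0 : NonZero d}} .{{e≢0 : NonZero e}} →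
  d ℕ.* e ≡ n → ∀ {s t k} → (∀ i → seq k i ≡ seq s i ℚ.* seq t i) →
  (N₁ : Neighbours d s) (N₂ : Neighbours e t) (N : Neighbours n k) →
  Neighbours.d₁ N₁ ℕ.* Neighbours.d₂ N₂ ℕ.≤ Neighbours.d₂ N₁ ℕ.* Neighbours.d₁ N₂ →
  u n k N ≤ℝ u d s N₁ *ℝ u e t N₂
u-submultiplicative {n} {d} {e} refl {s} {t} {k} k≗st N₁ N₂ N a₁b₂≤a₂b₁ = result
  where
  open Neighbours N₁ renaming (d₁ to a₁; d₂ to a₂; is-d₁ to is-a₁; is-d₂ to is-a₂)
  open Neighbours N₂ renaming (d₁ to b₁; d₂ to b₂; is-d₁ to is-b₁; is-d₂ to is-b₂)
  open Neighbours N renaming (d₁ to c₁; d₂ to c₂; is-d₁ to is-c₁; is-d₂ to is-c₂)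
  module A₁ = IsLargestDivisor≤ is-a₁
  module A₂ = IsSmallestDivisor≥ is-a₂
  module B₁ = IsLargestDivisor≤ is-b₁
  module B₂ = IsSmallestDivisor≥ is-b₂

  instance
    a₁≢0 : NonZero a₁
    a₁≢0 = divisor-nonZero A₁.divides
    a₂≢0 : NonZero a₂
    a₂≢0 = divisor-nonZero A₂.divides
    b₁≢0 : NonZero b₁
    b₁≢0 = divisor-nonZero B₁.divides
    b₂≢0 : NonZero b₂
    b₂≢0 = divisor-nonZero B₂.divides
    a₁a₂≢0 : NonZero (a₁ ℕ.* a₂)
    a₁a₂≢0 = ℕ.m*n≢0 a₁ a₂
    b₁b₂≢0 : NonZero (b₁ ℕ.* b₂)
    b₁b₂≢0 = ℕ.m*n≢0 b₁ b₂
    a₁b₁≢0 : NonZero (a₁ ℕ.* b₁)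
    a₁b₁≢0 = ℕ.m*n≢0 a₁ b₁
    a₁b₂≢0 : NonZero (a₁ ℕ.* b₂)
    a₁b₂≢0 = ℕ.m*n≢0 a₁ b₂
    a₂b₁≢0 : NonZero (a₂ ℕ.* b₁)
    a₂b₁≢0 = ℕ.m*n≢0 a₂ b₁
    a₂b₂≢0 : NonZero (a₂ ℕ.* b₂)
    a₂b₂≢0 = ℕ.m*n≢0 a₂ b₂

  ρ₁ ρ₂ : ℚ
  ρ₁ = + d ℚ./ (a₁ ℕ.* a₂)
  ρ₂ = + e ℚ./ (b₁ ℕ.* b₂)

  open ChordProduct {ρ₁} {ρ₂} {ι a₁} {ι a₂} {ι b₁} {ι b₂} {s} {t}
    (/-nonneg d (a₁ ℕ.* a₂)) (/-nonneg e (b₁ ℕ.* b₂))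
    (ι-pos a₁) (ι-pos a₂) (ι-pos b₁) (ι-pos b₂)
    A₁.bound A₂.bound B₁.bound B₂.bound

  a₁b₁≤c₁ : a₁ ℕ.* b₁ ℕ.≤ c₁
  a₁b₁≤c₁ = IsLargestDivisor≤.largest is-c₁ (a₁ ℕ.* b₁) (*-pres-∣ A₁.divides B₁.divides)
    (≤ℝ-resp {fromℚ (ι a₁ ℚ.* ι b₁)} {fromℕ (a₁ ℕ.* b₁)} {s *ℝ t} {k}
      (λ _ → sym (ι-* a₁ b₁)) (λ i → sym (k≗st i)) a₁b₁≤st)

  c₂≤a₂b₂ : c₂ ℕ.≤ a₂ ℕ.* b₂
  c₂≤a₂b₂ = IsSmallestDivisor≥.smallest is-c₂ (a₂ ℕ.* b₂) (*-pres-∣ A₂.divides B₂.divides)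
    (≤ℝ-resp {s *ℝ t} {k} {fromℚ (ι a₂ ℚ.* ι b₂)} {fromℕ (a₂ ℕ.* b₂)}
      (λ i → sym (k≗st i)) (λ _ → sym (ι-* a₂ b₂)) st≤a₂b₂)

  ιa₁b₂≤ιa₂b₁ : ι a₁ ℚ.* ι b₂ ℚ.≤ ι a₂ ℚ.* ι b₁
  ιa₁b₂≤ιa₂b₁ = subst₂ ℚ._≤_ (ι-* a₁ b₂) (ι-* a₂ b₁) (ι-mono a₁b₂≤a₂b₁)

  weight : (x y : ℕ) .{{_ : NonZero x}} .{{_ : NonZero y}} → ℚ
  weight x y = (+ n ℚ./ (x ℕ.* y)) {{ℕ.m*n≢0 x y}}

  weight-scaled : ∀ x y .{{_ : NonZero x}} .{{_ : NonZero y}} {p q} → ι x ≡ p → ι y ≡ q →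
    weight x y ℚ.* (p ℚ.* q) ≡ (ρ₁ ℚ.* (ι a₁ ℚ.* ι a₂)) ℚ.* (ρ₂ ℚ.* (ι b₁ ℚ.* ι b₂))
  weight-scaled x y refl refl =
    trans (/-*-*-cancel n x y {{ℕ.m*n≢0 x y}})
      (trans (ι-* d e) (sym (cong₂ ℚ._*_ (/-*-*-cancel d a₁ a₂) (/-*-*-cancel e b₁ b₂))))

  through : ∀ x y .{{_ : NonZero x}} .{{_ : NonZero y}} {p q} → ι x ≡ p → ι y ≡ q →
    x ℕ.≤ c₁ → c₂ ℕ.≤ y →
    chord (weight x y) p q (s *ℝ t) ≤ℝ u d s N₁ *ℝ u e t N₂ →
    u n k N ≤ℝ u d s N₁ *ℝ u e t N₂
  through x y refl refl x≤c₁ c₂≤y bound =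
    ≤ℝ-trans {u n k N} {divisorChord n x y k} {u d s N₁ *ℝ u e t N₂}
      (u-≤-divisorChord N x y x≤c₁ c₂≤y)
      (≤ℝ-resp {divisorChord n x y (s *ℝ t)} {divisorChord n x y k}
        {u d s N₁ *ℝ u e t N₂} {u d s N₁ *ℝ u e t N₂}
        (λ i → cong (λ r → weight x y ℚ.* (ι x ℚ.+ ι y ℚ.- r)) (sym (k≗st i)))
        (λ _ → refl) bound)

  result : u n k N ≤ℝ u d s N₁ *ℝ u e t N₂
  result with divisor-outside N (*-pres-∣ A₁.divides B₂.divides)
            | divisor-outside N (*-pres-∣ A₂.divides B₁.divides)
  ... | inj₂ c₂≤a₁b₂ | _ =
    through (a₁ ℕ.* b₁) (a₁ ℕ.* b₂) (ι-* a₁ b₁) (ι-* a₁ b₂) a₁b₁≤c₁ c₂≤a₁b₂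
      (low-≤-product {weight (a₁ ℕ.* b₁) (a₁ ℕ.* b₂)} ιa₁b₂≤ιa₂b₁
        (weight-scaled (a₁ ℕ.* b₁) (a₁ ℕ.* b₂) (ι-* a₁ b₁) (ι-* a₁ b₂)))
  ... | inj₁ a₁b₂≤c₁ | inj₂ c₂≤a₂b₁ =
    through (a₁ ℕ.* b₂) (a₂ ℕ.* b₁) (ι-* a₁ b₂) (ι-* a₂ b₁) a₁b₂≤c₁ c₂≤a₂b₁
      (middle-≤-product {weight (a₁ ℕ.* b₂) (a₂ ℕ.* b₁)}
        (weight-scaled (a₁ ℕ.* b₂) (a₂ ℕ.* b₁) (ι-* a₁ b₂) (ι-* a₂ b₁)))
  ... | inj₁ _ | inj₁ a₂b₁≤c₁ =
    through (a₂ ℕ.* b₁) (a₂ ℕ.* b₂) (ι-* a₂ b₁) (ι-* a₂ b₂) a₂b₁≤c₁ c₂≤a₂b₂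
      (high-≤-product {weight (a₂ ℕ.* b₁) (a₂ ℕ.* b₂)} ιa₁b₂≤ιa₂b₁
        (weight-scaled (a₂ ℕ.* b₁) (a₂ ℕ.* b₂) (ι-* a₂ b₁) (ι-* a₂ b₂)))

proposition1p4 : (n d : ℕ) .{{_ : NonZero n}} .{{_ : NonZero d}} (d∣n : d ∣ n) (s t : ℝ) →
    fromℕ 1 ≤ℝ s → s ≤ℝ fromℕ d →
    fromℕ 1 ≤ℝ t → t ≤ℝ fromℕ (n / d) →
    (N₁ : Neighbours d s) (N₂ : Neighbours (n / d) t) (N : Neighbours n (s *ℝ t)) →
    u n (s *ℝ t) N ≤ℝ u d s N₁ *ℝ u (n / d) {{cofactor-nonZero d∣n}} t N₂
proposition1p4 n d d∣n s t _ _ _ _ N₁ N₂ N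
  with ℕ.≤-total (Neighbours.d₁ N₁ ℕ.* Neighbours.d₂ N₂) (Neighbours.d₂ N₁ ℕ.* Neighbours.d₁ N₂)
... | inj₁ a₁b₂≤a₂b₁ = u-submultiplicative {{e≢0 = cofactor-nonZero d∣n}}
  (m*[n/m]≡n d∣n) {s} {t} {s *ℝ t} (λ _ → refl) N₁ N₂ N a₁b₂≤a₂b₁
... | inj₂ a₂b₁≤a₁b₂ =
  ≤ℝ-resp {u n (s *ℝ t) N} {u n (s *ℝ t) N} {uₜ *ℝ uₛ} {uₛ *ℝ uₜ}
    (λ _ → refl) (λ i → ℚ.*-comm (seq uₜ i) (seq uₛ i))
    (u-submultiplicative {{d≢0 = cofactor-nonZero d∣n}}
      (trans (ℕ.*-comm (n / d) d) (m*[n/m]≡n d∣n)) {t} {s} {s *ℝ t}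
      (λ i → ℚ.*-comm (seq s i) (seq t i)) N₂ N₁ N
      (subst₂ ℕ._≤_ (ℕ.*-comm (Neighbours.d₂ N₁) (Neighbours.d₁ N₂))
        (ℕ.*-comm (Neighbours.d₁ N₁) (Neighbours.d₂ N₂)) a₂b₁≤a₁b₂))
  where
  uₛ uₜ : ℝ
  uₛ = u d s N₁
  uₜ = u (n / d) {{cofactor-nonZero d∣n}} t N₂
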